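{- There exists a graph $G$ with no strongly minimal colouring, i.e. there is no family $\mathcal{C}$ of independent sets of $G$ whose union is $V(G)$ such that for every family $\mathcal{C}'$ of independent sets of $G$ whose union is $V(G)$ we have $|\mathcal{C}\setminus\mathcal{C}'|\leq|\mathcal{C}'\setminus\mathcal{C}|$.
   Context: Graphs may be infinite. A strongly minimal colouring of a graph $G$ is a strongly minimal cover of the vertex set by independent sets: a family $\mathcal{C}$ of independent sets covering $V(G)$ such that every other family $\mathcal{C}'$ of independent sets covering $V(G)$ satisfies $|\mathcal{C}\setminus\mathcal{C}'|\leq|\mathcal{C}'\setminus\mathcal{C}|$ (comparison of cardinalities). -}

module Defs where

open import Level using (Level; 0ℓ) renaming (suc to lsuc)
open import Data.Product using (Σ; ∃; _×_; _,_; proj₁)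
open import Relation.Nullary using (¬_)

record Graph : Set₁ where
  field
    V      : Set
    E      : V → V → Set
    E-sym  : ∀ {x y} → E x y → E y x
    E-irr  : ∀ {x} → ¬ E x x

Subset : Set → Set₁
Subset V = V → Set

_≐_ : {V : Set} → Subset V → Subset V → Set
S ≐ T = ∀ v → (S v → T v) × (T v → S v)

-- A family of subsets of V (a set of subsets; membership is read up to ≐).
Family : Set → Set₁
Family V = Subset V → Set

Diff : {V : Set} → Family V → Family V → Set₁
Diff {V} 𝒞 𝒞' = Σ (Subset V) λ S → 𝒞 S × ¬ (Σ (Subset V) λ T → 𝒞' T × (S ≐ T))

_≈D_ : {V : Set} {𝒞 𝒞' : Family V} → Diff 𝒞 𝒞' → Diff 𝒞 𝒞' → Set
x ≈D y = proj₁ x ≐ proj₁ y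

DiffCardLe : {V : Set} → (𝒞 𝒞' 𝒟 𝒟' : Family V) → Set₁
DiffCardLe 𝒞 𝒞' 𝒟 𝒟' =
  Σ (Diff 𝒞 𝒞' → Diff 𝒟 𝒟') λ f →
    (∀ x y → x ≈D y → f x ≈D f y) × (∀ x y → f x ≈D f y → x ≈D y)

module _ (G : Graph) where
  open Graph G

  Independent : Subset V → Set
  Independent S = ∀ x y → S x → S y → ¬ E x y

  IndepCover : Family V → Set₁
  IndepCover 𝒞 = (∀ S → 𝒞 S → Independent S) × (∀ v → Σ (Subset V) λ S → 𝒞 S × S v)

  StronglyMinimalColouring : Family V → Set₁
  StronglyMinimalColouring 𝒞 =
    IndepCover 𝒞 × (∀ 𝒞' → IndepCover 𝒞' → DiffCardLe 𝒞 𝒞' 𝒞' 𝒞)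

{-# OPTIONS --safe #-}
-- Colourings of the graph below are clique covers of its complement, which has
-- hubs x₀, x₁, x₂, … and, for every n, an n × (n + 1) rook grid Gₙ whose column i
-- is joined to xᵢ.  The rows cover Gₙ by n cliques; the columns need n + 1 cliques,
-- but they swallow x₀, …, xₙ on the way.  In a given cover, the class of a hub meets
-- at most one grid.  Let x₀ use Gₚ and let xₚ₊₁ use G_q; then q > p.  With m = q + 1,
-- the cover spends p + 1 classes on Gₚ and x₀, another q + 1 on G_q and xₚ₊₁, and m
-- on Gₘ, whereas the rows of Gₚ and G_q with the extended columns of Gₘ cover all
-- that these classes contain with one set fewer.
module Submission where

open import Defs
open import Data.Empty using (⊥)
open import Data.Fin.Base using (Fin; zero; suc; toℕ; fromℕ; fromℕ<; punchIn)
open import Data.Fin.Properties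
  using (toℕ-injective; toℕ-fromℕ; toℕ-fromℕ<; toℕ≤pred[n]; punchIn-injective;
         punchInᵢ≢i; pigeonhole; sequence; +↔⊎; <⇒≢)
open import Data.Nat.Base using (ℕ; suc; _+_; _≤_; _<_; s≤s)
open import Data.Nat.Properties as ℕ using (_≟_; _≤?_)
open import Data.Product using (Σ; ∃; ∃-syntax; _×_; _,_; proj₁; proj₂; swap)
open import Data.Sum.Base as Sum using (_⊎_; inj₁; inj₂)
open import Data.Sum.Function.Propositional using (_⊎-↔_)
open import Effect.Monad using (RawMonad)
open import Function.Base using (_∘_)
open import Function.Bundles using (Injection; _↣_; _↔_)
open import Function.Construct.Composition using (_↔-∘_)
open import Function.Construct.Identity using (↔-id)
open import Function.Construct.Symmetry using (↔-sym)
open import Function.Properties.Inverse using (↔⇒↣)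
open import Relation.Binary.PropositionalEquality
  using (_≡_; _≢_; refl; sym; trans; cong; subst)
open import Relation.Nullary
  using (¬_; Dec; yes; no; contradiction; ¬¬-excluded-middle; decidable-stable; _×-dec_; _⊎-dec_)
open import Relation.Nullary.Negation using (¬¬-Monad)

-- Equality of subsets and the exchange argument.

≐-refl : {V : Set} {S : Subset V} → S ≐ S
≐-refl v = (λ s → s) , (λ s → s)

≐-sym : {V : Set} {S T : Subset V} → S ≐ T → T ≐ S
≐-sym e = swap ∘ e

≐-trans : {V : Set} {S T U : Subset V} → S ≐ T → T ≐ U → S ≐ U
≐-trans e f v = proj₁ (f v) ∘ proj₁ (e v) , proj₂ (e v) ∘ proj₂ (f v)

module _ (G : Graph) {𝒞 : Family (Graph.V G)} (min : StronglyMinimalColouring G 𝒞) where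
  open Graph G

  -- Trade the classes `S i` for the fewer sets `B j`. The injection of `𝒞 ∖ 𝒞′` into `𝒞′ ∖ 𝒞` given
  -- by minimality then charges each `S i` to some `B j`, no two to the same one, against the
  -- pigeonhole principle.
  exchange : {I J : Set} {M N : ℕ} → N < M → Fin M ↣ I → J ↣ Fin N →
    (S : I → Subset V) → (∀ i → 𝒞 (S i)) → (∀ {i j} → i ≢ j → ¬ S i ≐ S j) →
    (B : J → Subset V) → (∀ j → Independent G (B j)) →
    (∀ v → (∃[ j ] B j v) ⊎ (Σ (Subset V) λ U → 𝒞 U × U v × (∀ i → ¬ U ≐ S i))) → ⊥
  exchange {I} {J} {M} N<M from to S S∈𝒞 S-distinct B B-indep covers =
    -- A slot exists only up to double negation, as membership in `𝒞′` is undecidable; over the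
    -- finite `Fin M` the double negations combine into one, and the goal is `⊥`.
    sequence (RawMonad.rawApplicative ¬¬-Monad) (slot ∘ Injection.to from) λ slots →
    let a , b , a<b , eq = pigeonhole N<M (Injection.to to ∘ proj₁ ∘ slots)
    in S-distinct (<⇒≢ a<b ∘ Injection.injective from)
         (slot-injective (proj₂ (slots a))
           (subst (Slot _) (sym (Injection.injective to eq)) (proj₂ (slots b))))
    where
    𝒞′ : Family V
    𝒞′ U = (𝒞 U × (∀ i → ¬ U ≐ S i)) ⊎ (∃[ j ] U ≐ B j)

    𝒞′-cover : IndepCover G 𝒞′
    𝒞′-cover = indep , λ v → Sum.[ (λ (j , b) → B j , inj₂ (j , ≐-refl) , b)
                                  , (λ (U , c , u , n) → U , inj₁ (c , n) , u) ]′ (covers v)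
      where
      indep : ∀ U → 𝒞′ U → Independent G U
      indep U (inj₁ (c , _)) = proj₁ (proj₁ min) U c
      indep U (inj₂ (j , e)) x y u u′ = B-indep j x y (proj₁ (e x) u) (proj₁ (e y) u′)

    f : Diff 𝒞 𝒞′ → Diff 𝒞′ 𝒞
    f = proj₁ (proj₂ min 𝒞′ 𝒞′-cover)

    -- S i may already be one of the new sets B j, and then it is not in 𝒞 ∖ 𝒞′.
    Slot : I → J → Set₁
    Slot i j = (Σ (Diff 𝒞 𝒞′) λ d → proj₁ d ≡ S i × proj₁ (f d) ≐ B j) ⊎ S i ≐ B j

    slot : ∀ i → ¬ ¬ (∃[ j ] Slot i j)
    -- The assumption `none` is what puts `S i` outside `𝒞′`, so that `f` applies; the image avoids
    -- `𝒞` and hence is some `B j`.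
    slot i none = none (slot-of (f d) refl)
      where
      d : Diff 𝒞 𝒞′
      d = S i , S∈𝒞 i , λ where
        (T , inj₁ (_ , new) , e) → new i (≐-sym e)
        (T , inj₂ (j , e′) , e) → none (j , inj₂ (≐-trans e e′))

      slot-of : (d′ : Diff 𝒞′ 𝒞) → f d ≡ d′ → ∃[ j ] Slot i j
      slot-of (T , inj₁ (c , _) , T∉𝒞) _ = contradiction (T , c , ≐-refl) T∉𝒞
      slot-of (T , inj₂ (j , e) , _) eq =
        j , inj₁ (d , refl , subst (λ d′ → proj₁ d′ ≐ B j) (sym eq) e)

    fresh : ∀ {i j} (d : Diff 𝒞 𝒞′) → proj₁ (f d) ≐ B j → ¬ S i ≐ B j
    fresh {i} d e e′ = proj₂ (proj₂ (f d)) (S i , S∈𝒞 i , ≐-trans e (≐-sym e′))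

    -- Two slots through `f` agree because `f` is injective. In the mixed cases `B j` would lie both
    -- outside `𝒞`, as a value of `f`, and inside it, as some `S i`.
    slot-injective : ∀ {i i′ j} → Slot i j → Slot i′ j → S i ≐ S i′
    slot-injective (inj₁ (d , refl , e)) (inj₁ (d′ , refl , e′)) =
      proj₂ (proj₂ (proj₂ min 𝒞′ 𝒞′-cover)) d d′ (≐-trans e (≐-sym e′))
    slot-injective (inj₁ (d , _ , e)) (inj₂ e′) = contradiction e′ (fresh d e)
    slot-injective (inj₂ e) (inj₁ (d , _ , e′)) = contradiction e (fresh d e′)
    slot-injective (inj₂ e) (inj₂ e′) = ≐-trans e (≐-sym e′)

-- The graph, its rows and columns, and its independent sets.

data Vertex : Set where
  hub  : ℕ → Vertex
  cell : (n : ℕ) → Fin n → Fin (suc n) → Vertex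

-- Adjacency in the complement, with loops added. `toℕ` allows comparison of rows and columns of
-- different grids.
_~_ : Vertex → Vertex → Set
hub i ~ hub j = i ≡ j
hub i ~ cell n r c = toℕ c ≡ i
cell n r c ~ hub i = toℕ c ≡ i
cell n r c ~ cell n′ r′ c′ = n ≡ n′ × (toℕ r ≡ toℕ r′ ⊎ toℕ c ≡ toℕ c′)

~-refl : ∀ x → x ~ x
~-refl (hub i) = refl
~-refl (cell n r c) = refl , inj₁ refl

~-sym : ∀ x y → x ~ y → y ~ x
~-sym (hub i) (hub j) = sym
~-sym (hub i) (cell n r c) e = e
~-sym (cell n r c) (hub i) e = e
~-sym (cell n r c) (cell n′ r′ c′) (e , e′) = sym e , Sum.map sym sym e′

_~?_ : ∀ x y → Dec (x ~ y)
hub i ~? hub j = i ≟ j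
hub i ~? cell n r c = toℕ c ≟ i
cell n r c ~? hub i = toℕ c ≟ i
cell n r c ~? cell n′ r′ c′ = (n ≟ n′) ×-dec ((toℕ r ≟ toℕ r′) ⊎-dec (toℕ c ≟ toℕ c′))

grids : Graph
grids = record
  { V = Vertex
  ; E = λ x y → ¬ x ~ y
  ; E-sym = λ {x} {y} ¬xy yx → ¬xy (~-sym y x yx)
  ; E-irr = λ {x} ¬xx → ¬xx (~-refl x)
  }

row : ∀ n → Fin n → Subset Vertex
row n r (hub i) = ⊥
row n r (cell n′ r′ c) = n ≡ n′ × toℕ r ≡ toℕ r′

column : ∀ n → Fin (suc n) → Subset Vertex
column n c (hub i) = toℕ c ≡ i
column n c (cell n′ r c′) = n ≡ n′ × toℕ c ≡ toℕ c′

row-independent : ∀ n r → Independent grids (row n r)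
row-independent n r (cell _ _ _) (cell _ _ _) (e , f) (e′ , f′) ¬xy =
  ¬xy (trans (sym e) e′ , inj₁ (trans (sym f) f′))

column-independent : ∀ n c → Independent grids (column n c)
column-independent n c (hub i) (hub j) e e′ ¬xy = ¬xy (trans (sym e) e′)
column-independent n c (hub i) (cell _ _ _) e (_ , f) ¬xy = ¬xy (trans (sym f) e)
column-independent n c (cell _ _ _) (hub i) (_ , f) e ¬xy = ¬xy (trans (sym f) e)
column-independent n c (cell _ _ _) (cell _ _ _) (e , f) (e′ , f′) ¬xy =
  ¬xy (trans (sym e) e′ , inj₂ (trans (sym f) f′))

-- Hub `k` and one cell from each row, in distinct columns other than `k`: these `suc n` vertices
-- force `suc n` different classes.
transversal : ∀ {n} → Fin (suc n) → Fin (suc n) → Vertex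
transversal k zero = hub (toℕ k)
transversal k (suc r) = cell _ r (punchIn k r)

transversal-clique : ∀ {n} (k : Fin (suc n)) {a b} → a ≢ b → ¬ transversal k a ~ transversal k b
transversal-clique k {zero} {zero} a≢b _ = a≢b refl
transversal-clique k {zero} {suc r} _ e = punchInᵢ≢i k r (toℕ-injective e)
transversal-clique k {suc r} {zero} _ e = punchInᵢ≢i k r (toℕ-injective e)
transversal-clique k {suc r} {suc r′} a≢b (_ , inj₁ e) = a≢b (cong suc (toℕ-injective e))
transversal-clique k {suc r} {suc r′} a≢b (_ , inj₂ e) =
  a≢b (cong suc (punchIn-injective k r r′ (toℕ-injective e)))

transversal-hub : ∀ {n} (k a : Fin (suc n)) {i} → transversal k a ~ hub i → i ≤ n
transversal-hub k zero refl = toℕ≤pred[n] k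
transversal-hub k (suc r) refl = toℕ≤pred[n] (punchIn k r)

CellsIn : ℕ → Subset Vertex → Set
CellsIn n S = ∀ n′ r c → S (cell n′ r c) → n′ ≡ n

independent-~ : ∀ {S} → Independent grids S → ∀ {x y} → S x → S y → x ~ y
independent-~ S-indep {x} {y} Sx Sy = decidable-stable (x ~? y) (S-indep x y Sx Sy)

cells-in : ∀ {S n r c} → Independent grids S → S (cell n r c) → CellsIn n S
cells-in S-indep s _ _ _ s′ = proj₁ (independent-~ S-indep s′ s)

hub-cells-in : ∀ {S i} → Independent grids S → S (hub i) →
  ¬ ¬ (∃[ n ] Σ (Fin (suc n)) λ k → toℕ k ≡ i × CellsIn n S)
hub-cells-in {S} {i} S-indep s none = none
  -- Grid `i` is the default for an `S` without cells, with the hub on its last column. A cell in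
  -- `S` would supply its own grid and column and so refute `none`.
  (i , fromℕ i , toℕ-fromℕ i , λ n′ r c s′ →
    contradiction (n′ , c , independent-~ S-indep s s′ , cells-in S-indep s′) none)

-- Improving a supposed strongly minimal colouring.

module _ {𝒞 : Family Vertex} (min : StronglyMinimalColouring grids 𝒞) where

  class : Vertex → Subset Vertex
  class v = proj₁ (proj₂ (proj₁ min) v)

  class∈𝒞 : ∀ v → 𝒞 (class v)
  class∈𝒞 v = proj₁ (proj₂ (proj₂ (proj₁ min) v))

  ∈class : ∀ v → class v v
  ∈class v = proj₂ (proj₂ (proj₂ (proj₁ min) v))

  class-independent : ∀ v → Independent grids (class v)
  class-independent v = proj₁ (proj₁ min) (class v) (class∈𝒞 v)

  ∈class⇒~ : ∀ {v w} → class v w → v ~ w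
  ∈class⇒~ {v} = independent-~ (class-independent v) (∈class v)

  ≐⇒∈class : ∀ {v w} → class v ≐ class w → class v w
  ≐⇒∈class {v} {w} e = proj₂ (e w) (∈class w)

  transversal-cells-in : ∀ {n} (k : Fin (suc n)) → CellsIn n (class (hub (toℕ k))) →
    ∀ a → CellsIn n (class (transversal k a))
  transversal-cells-in k k-in zero = k-in
  transversal-cells-in k k-in (suc r) = cells-in (class-independent _) (∈class _)

  -- If either vertex is a cell, a common class would hold a cell of one grid while confined to the
  -- other; two hubs in one class would be equal.
  transversals-distinct : ∀ {n n′} (k : Fin (suc n)) (k′ : Fin (suc n′)) a b →
    n ≢ n′ → toℕ k ≢ toℕ k′ →
    CellsIn n (class (transversal k a)) → CellsIn n′ (class (transversal k′ b)) →
    ¬ class (transversal k a) ≐ class (transversal k′ b)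
  transversals-distinct k k′ zero zero _ k≢k′ _ _ e = k≢k′ (∈class⇒~ (≐⇒∈class e))
  transversals-distinct k k′ a (suc r) n≢n′ _ in-n _ e = n≢n′ (sym (in-n _ _ _ (≐⇒∈class e)))
  transversals-distinct k k′ (suc r) zero n≢n′ _ _ in-n′ e = n≢n′ (in-n′ _ _ _ (≐⇒∈class (≐-sym e)))

  module _ {p q} (k : Fin (suc p)) (l : Fin (suc q)) (p<l : p < toℕ l)
           (k-in : CellsIn p (class (hub (toℕ k)))) (l-in : CellsIn q (class (hub (toℕ l)))) where

    m : ℕ
    m = suc q

    k<l : toℕ k < toℕ l
    k<l = ℕ.≤-<-trans (toℕ≤pred[n] k) p<l

    p<q : p < q
    p<q = ℕ.<-≤-trans p<l (toℕ≤pred[n] l)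

    p<m : p < m
    p<m = ℕ.m<n⇒m<1+n p<q

    q<m : q < m
    q<m = ℕ.n<1+n q

    -- With the last column skipped, the cells of this transversal form the diagonal of grid `m`;
    -- its hub is left out of the witnesses.
    top : Fin (suc m)
    top = fromℕ m

    below-top : ∀ {i} → i < m → i ≢ toℕ top
    below-top {i} i<m = subst (i ≢_) (sym (toℕ-fromℕ m)) (ℕ.<⇒≢ i<m)

    -- The rows save one set on each of grids `p` and `q`, and the columns cost one more on grid
    -- `m`: a net gain of one.
    Old New : Set
    Old = Fin (suc p) ⊎ (Fin (suc q) ⊎ Fin m)
    New = Fin p ⊎ (Fin q ⊎ Fin (suc m))

    witness : Old → Vertex
    witness (inj₁ a) = transversal k a
    witness (inj₂ (inj₁ a)) = transversal l a
    witness (inj₂ (inj₂ r)) = transversal top (suc r)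

    new : New → Subset Vertex
    new (inj₁ r) = row p r
    new (inj₂ (inj₁ r)) = row q r
    new (inj₂ (inj₂ c)) = column m c

    new-independent : ∀ j → Independent grids (new j)
    new-independent (inj₁ r) = row-independent p r
    new-independent (inj₂ (inj₁ r)) = row-independent q r
    new-independent (inj₂ (inj₂ c)) = column-independent m c

    grid : Old → ℕ
    grid (inj₁ _) = p
    grid (inj₂ (inj₁ _)) = q
    grid (inj₂ (inj₂ _)) = m

    witness-in : ∀ i → CellsIn (grid i) (class (witness i))
    witness-in (inj₁ a) = transversal-cells-in k k-in a
    witness-in (inj₂ (inj₁ a)) = transversal-cells-in l l-in a
    witness-in (inj₂ (inj₂ r)) = cells-in (class-independent _) (∈class _)

    -- Every hub lost with the discarded classes is thus recovered by a column of grid `m`.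
    witness-hub : ∀ i {h} → class (witness i) (hub h) → h ≤ m
    witness-hub (inj₁ a) s = ℕ.≤-trans (transversal-hub k a (∈class⇒~ s)) (ℕ.<⇒≤ p<m)
    witness-hub (inj₂ (inj₁ a)) s = ℕ.≤-trans (transversal-hub l a (∈class⇒~ s)) (ℕ.<⇒≤ q<m)
    witness-hub (inj₂ (inj₂ r)) s = transversal-hub top (suc r) (∈class⇒~ s)

    Apart : Old → Old → Set
    Apart i j = ¬ class (witness i) ≐ class (witness j)

    k-apart-l : ∀ a b → Apart (inj₁ a) (inj₂ (inj₁ b))
    k-apart-l a b = transversals-distinct k l a b (ℕ.<⇒≢ p<q) (ℕ.<⇒≢ k<l)
      (witness-in (inj₁ a)) (witness-in (inj₂ (inj₁ b)))

    k-apart-top : ∀ a r → Apart (inj₁ a) (inj₂ (inj₂ r))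
    k-apart-top a r = transversals-distinct k top a (suc r) (ℕ.<⇒≢ p<m)
      (below-top (ℕ.≤-<-trans (toℕ≤pred[n] k) p<m))
      (witness-in (inj₁ a)) (witness-in (inj₂ (inj₂ r)))

    l-apart-top : ∀ a r → Apart (inj₂ (inj₁ a)) (inj₂ (inj₂ r))
    l-apart-top a r = transversals-distinct l top a (suc r) (ℕ.<⇒≢ q<m)
      (below-top (s≤s (toℕ≤pred[n] l)))
      (witness-in (inj₂ (inj₁ a))) (witness-in (inj₂ (inj₂ r)))

    old-distinct : ∀ {i j} → i ≢ j → Apart i j
    old-distinct {inj₁ a} {inj₁ b} i≢j e =
      transversal-clique k (i≢j ∘ cong inj₁) (∈class⇒~ (≐⇒∈class e))
    old-distinct {inj₁ a} {inj₂ (inj₁ b)} _ = k-apart-l a b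
    old-distinct {inj₁ a} {inj₂ (inj₂ r)} _ = k-apart-top a r
    old-distinct {inj₂ (inj₁ a)} {inj₁ b} _ = k-apart-l b a ∘ ≐-sym
    old-distinct {inj₂ (inj₁ a)} {inj₂ (inj₁ b)} i≢j e =
      transversal-clique l (i≢j ∘ cong (inj₂ ∘ inj₁)) (∈class⇒~ (≐⇒∈class e))
    old-distinct {inj₂ (inj₁ a)} {inj₂ (inj₂ r)} _ = l-apart-top a r
    old-distinct {inj₂ (inj₂ r)} {inj₁ a} _ = k-apart-top a r ∘ ≐-sym
    old-distinct {inj₂ (inj₂ r)} {inj₂ (inj₁ a)} _ = l-apart-top a r ∘ ≐-sym
    old-distinct {inj₂ (inj₂ r)} {inj₂ (inj₂ r′)} i≢j e =
      transversal-clique top {suc r} {suc r′} (λ { refl → i≢j refl }) (∈class⇒~ (≐⇒∈class e))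

    untouched : ∀ {v} → (∀ i → ¬ class (witness i) v) →
      Σ (Subset Vertex) λ U → 𝒞 U × U v × (∀ i → ¬ U ≐ class (witness i))
    untouched {v} v∉ =
      class v , class∈𝒞 v , ∈class v , λ i e → v∉ i (proj₁ (e v) (∈class v))

    covers : ∀ v → (∃[ j ] new j v) ⊎
      (Σ (Subset Vertex) λ U → 𝒞 U × U v × (∀ i → ¬ U ≐ class (witness i)))
    covers (hub h) with h ≤? m
    ... | yes h≤m = inj₁ (inj₂ (inj₂ (fromℕ< (s≤s h≤m))) , toℕ-fromℕ< (s≤s h≤m))
    ... | no h≰m = inj₂ (untouched λ i s → h≰m (witness-hub i s))
    covers (cell n r c) with n ≟ p | n ≟ q | n ≟ m
    ... | yes refl | _ | _ = inj₁ (inj₁ r , refl , refl)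
    ... | no _ | yes refl | _ = inj₁ (inj₂ (inj₁ r) , refl , refl)
    ... | no _ | no _ | yes refl = inj₁ (inj₂ (inj₂ c) , refl , refl)
    ... | no n≢p | no n≢q | no n≢m = inj₂ (untouched λ where
      i@(inj₁ _) s → n≢p (witness-in i n r c s)
      i@(inj₂ (inj₁ _)) s → n≢q (witness-in i n r c s)
      i@(inj₂ (inj₂ _)) s → n≢m (witness-in i n r c s))

    +³↔⊎³ : ∀ {x y z} → Fin (x + (y + z)) ↔ (Fin x ⊎ (Fin y ⊎ Fin z))
    +³↔⊎³ = (↔-id _ ⊎-↔ +↔⊎) ↔-∘ +↔⊎

    improvable : ⊥
    improvable = exchange grids min
      -- The successor of `p + (q + suc m)` is exactly `suc p + (suc q + m)`.
      (ℕ.≤-reflexive (cong (λ x → suc (p + x)) (ℕ.+-suc q m)))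
      (↔⇒↣ +³↔⊎³) (↔⇒↣ (↔-sym +³↔⊎³))
      (class ∘ witness) (class∈𝒞 ∘ witness) old-distinct new new-independent covers

  no-strongly-minimal : ⊥
  no-strongly-minimal =
    hub-cells-in (class-independent (hub 0)) (∈class (hub 0)) λ where
      (p , k , k≡0 , k-in) →
        -- The last column of grid `p` has index `p`, so hub `suc p` is forced onto a larger grid.
        hub-cells-in (class-independent (hub (suc p))) (∈class (hub (suc p))) λ where
          (q , l , l≡1+p , l-in) →
            improvable k l (ℕ.≤-reflexive (sym l≡1+p))
              (subst (λ i → CellsIn p (class (hub i))) (sym k≡0) k-in)
              (subst (λ i → CellsIn q (class (hub i))) (sym l≡1+p) l-in)

theorem1p5 : Σ Graph λ G → ¬ (Σ (Family (Graph.V G)) λ 𝒞 → StronglyMinimalColouring G 𝒞)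
theorem1p5 = grids , λ (𝒞 , min) → no-strongly-minimal min
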